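{- Let $G=(V,E)$ be a locally finite simple graph and $x\in V$. If there exist $\mathcal N_1<\mathcal N_2$ in $(0,\infty]$ such that $\mathcal K_{G,x}(\mathcal N_1)=\mathcal K_{G,x}(\mathcal N_2)$, then $$\mathcal K_{G,x}(\mathcal N)=\mathcal K_{G,x}(\mathcal N_1)\qquad\text{for all }\mathcal N\in[\mathcal N_1,\infty].$$
   Context: Graphs are undirected, without loops or multiple edges, and every vertex has finite degree; $d_x$ is the degree of $x$, and the vertex $x$ considered has $d_x\ge1$. For $f:V\to\mathbb R$ put $\Delta f(x)=\sum_{y\sim x}(f(y)-f(x))$ (non-normalized Laplacian), and for $f,g:V\to\mathbb R$ put $2\Gamma(f,g)=\Delta(fg)-f\Delta g-g\Delta f$, $2\Gamma_2(f,g)=\Delta\Gamma(f,g)-\Gamma(f,\Delta g)-\Gamma(\Delta f,g)$, $\Gamma(f)=\Gamma(f,f)$, $\Gamma_2(f)=\Gamma_2(f,f)$. For $\mathcal N\in(0,\infty]$ (convention $1/\infty=0$), $\mathcal K_{G,x}(\mathcal N)$ is the largest $K\in\mathbb R$ such that $\Gamma_2(f)(x)\ge\frac1{\mathcal N}(\Delta f(x))^2+K\,\Gamma(f)(x)$ for all $f:V\to\mathbb R$ (Bakry-Émery curvature function). -}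

module Defs where

open import Algebra.Bundles using (CommutativeRing)
open import Data.List.Base using (List; foldr; length; map)
open import Data.List.Membership.Propositional using (_∈_)
open import Data.List.Relation.Unary.Unique.Propositional using (Unique)
open import Data.Nat.Base as ℕ using (ℕ)
open import Data.Product.Base using (Σ; ∃; _×_; _,_; proj₁)
open import Data.Sum.Base using (_⊎_; inj₂)
open import Function.Bundles using (_⇔_)
open import Level using (Level; suc; _⊔_)
open import Relation.Binary.Core using (Rel)
open import Relation.Binary.Definitions using (Cotransitive; Irreflexive; Symmetric)
open import Relation.Binary.PropositionalEquality.Core using (_≡_)
open import Relation.Binary.Structures using (IsStrictPartialOrder)
open import Relation.Nullary.Construct.Add.Supremum using (_⁺; [_]; ⊤⁺)
open import Relation.Nullary.Negation.Core using (¬_)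
import Algebra.Definitions as AlgebraDefinitions
import Algebra.Definitions.RawMonoid as RawMonoidDefinitions
import Relation.Binary.Construct.Add.Supremum.NonStrict as Sup≤
import Relation.Binary.Construct.Add.Supremum.Strict as Sup<

-- The real numbers, given by their axioms as a Cauchy-complete Archimedean
-- ordered field; classically these determine ℝ up to unique isomorphism.
-- The axioms are in constructive form: the order is cotransitive instead of
-- decidable, inverses are required for the elements apart from 0#,
-- and _≤_ is the negation of the reversed _<_.
record RealNumbers (c ℓ₁ ℓ₂ : Level) : Set (suc (c ⊔ ℓ₁ ⊔ ℓ₂)) where
  field
    commutativeRing : CommutativeRing c ℓ₁
  open CommutativeRing commutativeRing public

  infix 4 _<_ _≤_

  field
    _<_                  : Rel Carrier ℓ₂
    isStrictPartialOrder : IsStrictPartialOrder _≈_ _<_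
    <-cotransitive       : Cotransitive _<_
    <-tight              : ∀ {x y} → ¬ (x < y) → ¬ (y < x) → x ≈ y
    0<1                  : 0# < 1#
    +-monoˡ-<            : ∀ {x y} z → x < y → x + z < y + z
    *-pos                : ∀ {x y} → 0# < x → 0# < y → 0# < x * y

  _≤_ : Rel Carrier ℓ₂
  x ≤ y = ¬ (y < x)

  open AlgebraDefinitions _≈_ using (Invertible)
  open RawMonoidDefinitions +-rawMonoid using () renaming (_×_ to _·_)

  field
    #0⇒invertible : ∀ {x} → x < 0# ⊎ 0# < x → Invertible 1# _*_ x
    archimedean   : ∀ x → ∃ λ (n : ℕ) → x < n · 1#

  -- m and n range symmetrically, so the one-sided bound controls ∣ s m - s n ∣.
  IsCauchy : (ℕ → Carrier) → Set (c ⊔ ℓ₂)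
  IsCauchy s = ∀ ε → 0# < ε →
    ∃ λ M → ∀ m n → M ℕ.≤ m → M ℕ.≤ n → s m < s n + ε

  ConvergesTo : (ℕ → Carrier) → Carrier → Set (c ⊔ ℓ₂)
  ConvergesTo s l = ∀ ε → 0# < ε →
    ∃ λ M → ∀ n → M ℕ.≤ n → (s n < l + ε) × (l < s n + ε)

  field
    complete : ∀ s → IsCauchy s → ∃ (ConvergesTo s)

  Positive : Set (c ⊔ ℓ₂)
  Positive = Σ Carrier (0# <_)

  inverse : Positive → Carrier
  inverse (x , 0<x) = proj₁ (#0⇒invertible (inj₂ 0<x))

  0<2 : 0# < 1# + 1#
  0<2 = SPO.trans 0<1 (SPO.<-respˡ-≈ (+-identityˡ 1#) (+-monoˡ-< 1# 0<1))
    where module SPO = IsStrictPartialOrder isStrictPartialOrder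

  ½ : Carrier
  ½ = inverse (1# + 1# , 0<2)

  -- The interval (0,∞].
  Dimension : Set (c ⊔ ℓ₂)
  Dimension = Positive ⁺

  infix 4 _<ᵈ_ _≤ᵈ_

  _<ᵈ_ : Rel Dimension (c ⊔ ℓ₂)
  _<ᵈ_ = Sup<._<⁺_ (λ (p q : Positive) → proj₁ p < proj₁ q)

  _≤ᵈ_ : Rel Dimension (c ⊔ ℓ₂)
  _≤ᵈ_ = Sup≤._≤⁺_ (λ (p q : Positive) → proj₁ p ≤ proj₁ q)

  1/_ : Dimension → Carrier
  1/ [ p ] = inverse p
  1/ ⊤⁺    = 0#

-- Local finiteness is a duplicate-free enumeration of the neighbours of each
-- vertex.
record LocallyFiniteGraph (v e : Level) : Set (suc (v ⊔ e)) where
  infix 4 _∼_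
  field
    V                : Set v
    _∼_              : Rel V e
    ∼-sym            : Symmetric _∼_
    ∼-irrefl         : Irreflexive _≡_ _∼_
    neighbours       : V → List V
    neighbours-uniq  : ∀ x → Unique (neighbours x)
    ∈-neighbours     : ∀ x y → (y ∈ neighbours x) ⇔ (x ∼ y)

  degree : V → ℕ
  degree x = length (neighbours x)

module BakryÉmery {c ℓ₁ ℓ₂ v e : Level}
  (ℝ : RealNumbers c ℓ₁ ℓ₂) (G : LocallyFiniteGraph v e) where

  open RealNumbers ℝ
  open LocallyFiniteGraph G

  Fun : Set (c ⊔ v)
  Fun = V → Carrier

  infixl 7 _*ᶠ_
  infixl 6 _-ᶠ_

  _*ᶠ_ _-ᶠ_ : Fun → Fun → Fun
  (f *ᶠ g) x = f x * g x
  (f -ᶠ g) x = f x - g x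

  Δ : Fun → Fun
  Δ f x = foldr _+_ 0# (map (λ y → f y - f x) (neighbours x))

  Γ : Fun → Fun → Fun
  Γ f g x = ½ * (Δ (f *ᶠ g) -ᶠ f *ᶠ Δ g -ᶠ g *ᶠ Δ f) x

  Γ₂ : Fun → Fun → Fun
  Γ₂ f g x = ½ * (Δ (Γ f g) -ᶠ Γ f (Δ g) -ᶠ Γ (Δ f) g) x

  -- The curvature-dimension inequality CD(K, N) at the vertex x.
  CD : V → Carrier → Dimension → Set (c ⊔ ℓ₂ ⊔ v)
  CD x K N = ∀ (f : Fun) →
    (1/ N) * (Δ f x * Δ f x) + K * Γ f f x ≤ Γ₂ f f x

  -- The graph of the curvature function: K is the largest real number
  -- satisfying CD(K, N) at x.
  Is𝒦 : V → Dimension → Carrier → Set (c ⊔ ℓ₂ ⊔ v)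
  Is𝒦 x N K = CD x K N × (∀ K′ → CD x K′ N → K′ ≤ K)

{-# OPTIONS --safe #-}

-- For fixed f the inequality CD(K, N) is affine in (K, 1/N), so the set of
-- pairs (K, t) satisfying it with t in place of 1/N is convex, and it is
-- downward closed in t because (Δ f x)² is nonnegative. If K′ > K₁ were
-- admissible at some t ≥ 0, then so would be a proper convex combination of
-- (K′, t) and (K₁, 1/N₁) with second coordinate at least 1/N₂, and its first
-- coordinate would exceed K₂ = K₁.
module Submission where

open import Defs
open import Data.Nat.Base as ℕ using (ℕ)
open import Data.Product.Base using (_,_; proj₁; proj₂)
open import Data.Sum.Base using (inj₂; [_,_]′)
open import Level using (Level)
open import Relation.Binary.Structures using (IsStrictPartialOrder)
open import Relation.Nullary.Construct.Add.Supremum using ([_]; ⊤⁺)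
open import Relation.Nullary.Negation.Core using (¬_)
import Algebra.Properties.Ring as RingProperties
import Algebra.Solver.Ring.NaturalCoefficients.Default as NaturalCoefficients
import Relation.Binary.Construct.Add.Supremum.NonStrict as Sup≤
import Relation.Binary.Construct.Add.Supremum.Strict as Sup<

module RealProperties {c ℓ₁ ℓ₂ : Level} (ℝ : RealNumbers c ℓ₁ ℓ₂) where
  open RealNumbers ℝ
  open IsStrictPartialOrder isStrictPartialOrder public
    using (<-respˡ-≈; <-respʳ-≈) renaming (irrefl to <-irrefl; asym to <-asym)
  open RingProperties ring using (-‿distribˡ-*; -‿distribʳ-*; -‿involutive)
  open NaturalCoefficients commutativeSemiring using (solve; _:=_; _:*_)

  ≤-respˡ-≈ : ∀ {x y z} → x ≈ y → x ≤ z → y ≤ z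
  ≤-respˡ-≈ x≈y x≤z z<y = x≤z (<-respʳ-≈ (sym x≈y) z<y)

  ≤-respʳ-≈ : ∀ {x y z} → x ≈ y → z ≤ x → z ≤ y
  ≤-respʳ-≈ x≈y z≤x y<z = z≤x (<-respˡ-≈ (sym x≈y) y<z)

  -- Cotransitivity splits `z < x` at `y`, and each alternative contradicts one of the two
  -- hypotheses.
  ≤-trans : ∀ {x y z} → x ≤ y → y ≤ z → x ≤ z
  ≤-trans {y = y} x≤y y≤z z<x = [ y≤z , x≤y ]′ (<-cotransitive z<x y)

  ≤-refl : ∀ {x} → x ≤ x
  ≤-refl = <-irrefl refl

  x+y-y≈x : ∀ x y → (x + y) - y ≈ x
  x+y-y≈x x y = trans (+-assoc x y (- y)) (trans (+-congˡ (-‿inverseʳ y)) (+-identityʳ x))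

  x+[y-x]≈y : ∀ x y → x + (y - x) ≈ y
  x+[y-x]≈y x y = trans (sym (+-assoc x y (- x))) (trans (+-congʳ (+-comm x y)) (x+y-y≈x y x))

  x<y⇒0<y-x : ∀ {x y} → x < y → 0# < y - x
  x<y⇒0<y-x {x} x<y = <-respˡ-≈ (-‿inverseʳ x) (+-monoˡ-< (- x) x<y)

  +-monoˡ-≤ : ∀ {x y} z → x ≤ y → x + z ≤ y + z
  +-monoˡ-≤ {x} {y} z x≤y y+z<x+z =
    x≤y (<-respʳ-≈ (x+y-y≈x x z) (<-respˡ-≈ (x+y-y≈x y z) (+-monoˡ-< (- z) y+z<x+z)))

  +-mono-≤ : ∀ {x y u v} → x ≤ y → u ≤ v → x + u ≤ y + v
  +-mono-≤ {x} {y} {u} {v} x≤y u≤v = ≤-trans (+-monoˡ-≤ u x≤y)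
    (≤-respˡ-≈ (+-comm u y) (≤-respʳ-≈ (+-comm v y) (+-monoˡ-≤ y u≤v)))

  x≤y+x : ∀ {x y} → 0# ≤ y → x ≤ y + x
  x≤y+x {x} 0≤y = ≤-respˡ-≈ (+-identityˡ x) (+-monoˡ-≤ x 0≤y)

  *-monoˡ-< : ∀ {x y} z → 0# < z → x < y → z * x < z * y
  *-monoˡ-< {x} {y} z 0<z x<y =
    <-respˡ-≈ (+-identityˡ (z * x)) (<-respʳ-≈ z[y-x]+zx≈zy
      (+-monoˡ-< (z * x) (*-pos 0<z (x<y⇒0<y-x x<y))))
    where
    z[y-x]+zx≈zy : z * (y - x) + z * x ≈ z * y
    z[y-x]+zx≈zy = trans (sym (distribˡ z (y - x) x))
      (*-congˡ (trans (+-comm (y - x) x) (x+[y-x]≈y x y)))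

  *-cancelˡ-≤ : ∀ {x y} z → 0# < z → z * x ≤ z * y → x ≤ y
  *-cancelˡ-≤ z 0<z zx≤zy y<x = zx≤zy (*-monoˡ-< z 0<z y<x)

  -- If z y < z x then z is not positive: 0 < z would exclude x < y, leaving
  -- x ≈ y by tightness. Hence z ≈ 0, again by tightness.
  *-monoˡ-≤ : ∀ {x y} z → 0# ≤ z → x ≤ y → z * x ≤ z * y
  *-monoˡ-≤ {x} {y} z 0≤z x≤y zy<zx = <-irrefl (trans (z*w≈0 y) (sym (z*w≈0 x))) zy<zx
    where
    0≮z : ¬ (0# < z)
    0≮z 0<z = <-irrefl (*-congˡ (sym (<-tight (λ x<y → <-asym zy<zx (*-monoˡ-< z 0<z x<y)) x≤y))) zy<zx

    z*w≈0 : ∀ w → z * w ≈ 0#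
    z*w≈0 w = trans (*-congʳ (<-tight 0≤z 0≮z)) (zeroˡ w)

  *-monoʳ-≤ : ∀ {x y} z → 0# ≤ z → x ≤ y → x * z ≤ y * z
  *-monoʳ-≤ {x} {y} z 0≤z x≤y =
    ≤-respˡ-≈ (*-comm z x) (≤-respʳ-≈ (*-comm z y) (*-monoˡ-≤ z 0≤z x≤y))

  0≤x*y : ∀ {x y} → 0# ≤ x → 0# ≤ y → 0# ≤ x * y
  0≤x*y {x} 0≤x 0≤y = ≤-respˡ-≈ (zeroʳ x) (*-monoˡ-≤ x 0≤x 0≤y)

  -- The sign of `x` cannot be decided. Instead, `x * x < 0#` rules out both signs, so `x ≈ 0#` by
  -- tightness, and then the square vanishes.
  0≤x² : ∀ x → 0# ≤ x * x
  0≤x² x x²<0 = <-irrefl (trans (*-congʳ x≈0) (zeroˡ x)) x²<0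
    where
    x≮0 : ¬ (x < 0#)
    x≮0 x<0 = <-asym x²<0 (<-respʳ-≈ [-x]²≈x² (*-pos 0<-x 0<-x))
      where
      [-x]²≈x² : - x * - x ≈ x * x
      [-x]²≈x² = trans (sym (-‿distribˡ-* x (- x)))
        (trans (-‿cong (sym (-‿distribʳ-* x x))) (-‿involutive (x * x)))

      0<-x : 0# < - x
      0<-x = <-respʳ-≈ (+-identityˡ (- x)) (x<y⇒0<y-x x<0)

    x≈0 : x ≈ 0#
    x≈0 = <-tight x≮0 (λ 0<x → <-asym x²<0 (*-pos 0<x 0<x))

  inverseʳ : ∀ p → proj₁ p * inverse p ≈ 1#
  inverseʳ (x , 0<x) = proj₂ (proj₂ (#0⇒invertible (inj₂ 0<x)))

  0≤1/ : ∀ N → 0# ≤ 1/ N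
  0≤1/ ⊤⁺ = ≤-refl
  0≤1/ [ p@(x , 0<x) ] = *-cancelˡ-≤ x 0<x
    (≤-respˡ-≈ (sym (zeroʳ x)) (≤-respʳ-≈ (sym (inverseʳ p)) (<-asym 0<1)))

  [x*y]/x≈y : ∀ p y → (proj₁ p * y) * inverse p ≈ y
  [x*y]/x≈y p y = trans
    (solve 3 (λ a b i → (a :* b) :* i := (a :* i) :* b) refl (proj₁ p) y (inverse p))
    (trans (*-congʳ (inverseʳ p)) (*-identityˡ y))

  [x*y]/y≈x : ∀ x p → (x * proj₁ p) * inverse p ≈ x
  [x*y]/y≈x x p = trans (*-congʳ (*-comm x (proj₁ p))) ([x*y]/x≈y p x)

  1/-antimono-≤ : ∀ {M N} → M ≤ᵈ N → 1/ N ≤ 1/ M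
  1/-antimono-≤ {M} (_ Sup≤.≤⊤⁺) = 0≤1/ M
  1/-antimono-≤ {[ p@(x , 0<x) ]} {[ q@(y , 0<y) ]} Sup≤.[ x≤y ] =
    *-cancelˡ-≤ (x * y) (*-pos 0<x 0<y)
      (≤-respˡ-≈ (sym ([x*y]/y≈x x q)) (≤-respʳ-≈ (sym ([x*y]/x≈y p y)) x≤y))

  -- The conclusion is the double negation of `1/ N < 1/ M`, which is enough for proving any `_≤_`,
  -- itself a negation. Clearing denominators in `1/ M ≤ 1/ N` gives `1# ≤ 0#` or `y ≤ x`.
  1/-antimono-< : ∀ {M N} → M <ᵈ N → ¬ (1/ M ≤ 1/ N)
  1/-antimono-< {[ p@(x , 0<x) ]} Sup<.[ _ ]<⊤⁺ 1/x≤0 =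
    ≤-respˡ-≈ (inverseʳ p) (≤-respʳ-≈ (zeroʳ x) (*-monoˡ-≤ x (<-asym 0<x) 1/x≤0)) 0<1
  1/-antimono-< {[ p@(x , 0<x) ]} {[ q@(y , 0<y) ]} Sup<.[ x<y ] 1/x≤1/y =
    ≤-respˡ-≈ ([x*y]/x≈y p y) (≤-respʳ-≈ ([x*y]/y≈x x q)
      (*-monoˡ-≤ (x * y) (<-asym (*-pos 0<x 0<y)) 1/x≤1/y)) x<y

module CurvatureDimension {c ℓ₁ ℓ₂ v e : Level}
  (ℝ : RealNumbers c ℓ₁ ℓ₂) (G : LocallyFiniteGraph v e) where
  open RealNumbers ℝ
  open RealProperties ℝ
  open LocallyFiniteGraph G
  open BakryÉmery ℝ G
  open NaturalCoefficients commutativeSemiring using (solve; _:=_; _:*_; _:+_)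

  -- CD x K N is Admissible x K (1/ N).
  Admissible : V → Carrier → Carrier → Set _
  Admissible x K t = ∀ f → t * (Δ f x * Δ f x) + K * Γ f f x ≤ Γ₂ f f x

  Admissible-antimono : ∀ {x K s t} → s ≤ t → Admissible x K t → Admissible x K s
  Admissible-antimono {x} s≤t adm f =
    ≤-trans (+-monoˡ-≤ _ (*-monoʳ-≤ _ (0≤x² (Δ f x)) s≤t)) (adm f)

  -- The two inequalities are scaled and added; `α + β ≈ 1#` merges the right-hand sides into one
  -- `Γ₂ f f x`.
  Admissible-convex : ∀ {x K L s t} α β → 0# ≤ α → 0# ≤ β → α + β ≈ 1# →
    Admissible x K s → Admissible x L t → Admissible x (α * K + β * L) (α * s + β * t)
  Admissible-convex {x} {K} {L} {s} {t} α β 0≤α 0≤β α+β≈1 admK admL f =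
    ≤-respˡ-≈
      (solve 8 (λ α β s t K L d g →
        α :* (s :* d :+ K :* g) :+ β :* (t :* d :+ L :* g) :=
        (α :* s :+ β :* t) :* d :+ (α :* K :+ β :* L) :* g)
        refl α β s t K L (Δ f x * Δ f x) (Γ f f x))
      (≤-respʳ-≈
        (trans (sym (distribʳ (Γ₂ f f x) α β)) (trans (*-congʳ α+β≈1) (*-identityˡ _)))
        (+-mono-≤ (*-monoˡ-≤ α 0≤α (admK f)) (*-monoˡ-≤ β 0≤β (admL f))))

  -- The weights are α = (t₁ - t₂) / t₁ and β = t₂ / t₁, where tᵢ = 1/ Nᵢ.
  maximal : ∀ {x N₁ N₂ K t} → N₁ <ᵈ N₂ → CD x K N₁ → (∀ L → CD x L N₂ → L ≤ K) →
    0# ≤ t → ∀ K′ → Admissible x K′ t → K′ ≤ K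
  -- Nothing lies above ∞, so `N₁` is a finite `n`.
  maximal {N₁ = ⊤⁺} ()
  maximal {x} {[ p@(n , 0<n) ]} {N₂} {K} {t} N₁<N₂ cd max 0≤t K′ adm K<K′ =
    -- With `K<K′` assumed the goal is absurdity, so the doubly negated `t₂ < t₁` may be used
    -- outright.
    1/-antimono-< N₁<N₂ λ t₂<t₁ →
    let 0<a = x<y⇒0<y-x t₂<t₁
        0<α = *-pos 0<n 0<a
        0≤β = 0≤x*y (<-asym 0<n) (0≤1/ N₂)
    in max (α * K′ + β * K)
      (Admissible-antimono (t₂≤αt+βt₁ (<-asym 0<α))
        (Admissible-convex α β (<-asym 0<α) 0≤β α+β≈1 adm cd))
      -- Strictness comes from `0# < α`: replacing `K` by `K′` in `α * K + β * K ≈ K` increases it.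
      (<-respˡ-≈ αK+βK≈K (+-monoˡ-< (β * K) (*-monoˡ-< α 0<α K<K′)))
    where
    t₁ t₂ α β : Carrier
    t₁ = inverse p
    t₂ = 1/ N₂
    -- As `t₁` is the inverse of `n`, dividing by `t₁` is multiplying by `n`.
    α = n * (t₁ - t₂)
    β = n * t₂

    α+β≈1 : α + β ≈ 1#
    α+β≈1 = trans (sym (distribˡ n (t₁ - t₂) t₂))
      (trans (*-congˡ (trans (+-comm (t₁ - t₂) t₂) (x+[y-x]≈y t₂ t₁))) (inverseʳ p))

    αK+βK≈K : α * K + β * K ≈ K
    αK+βK≈K = trans (sym (distribʳ K α β)) (trans (*-congʳ α+β≈1) (*-identityˡ K))

    t₂≤αt+βt₁ : 0# ≤ α → t₂ ≤ α * t + β * t₁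
    t₂≤αt+βt₁ 0≤α =
      -- `β * t₁` is exactly `t₂`, and `α * t` only adds a nonnegative amount.
      ≤-respˡ-≈ ([x*y]/x≈y p t₂) (x≤y+x (0≤x*y 0≤α 0≤t))

proposition4p5 :
    ∀ {c ℓ₁ ℓ₂ v e : Level} (ℝ : RealNumbers c ℓ₁ ℓ₂) (G : LocallyFiniteGraph v e) →
    let open RealNumbers ℝ
        open LocallyFiniteGraph G
        open BakryÉmery ℝ G in
    (x : V) → 1 ℕ.≤ degree x →
    (N₁ N₂ : Dimension) → N₁ <ᵈ N₂ →
    (K₁ K₂ : Carrier) → Is𝒦 x N₁ K₁ → Is𝒦 x N₂ K₂ → K₁ ≈ K₂ →
    (N : Dimension) → N₁ ≤ᵈ N → Is𝒦 x N K₁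
proposition4p5 ℝ G x _ N₁ N₂ N₁<N₂ K₁ K₂ (cd₁ , _) (_ , max₂) K₁≈K₂ N N₁≤N =
    Admissible-antimono (1/-antimono-≤ N₁≤N) cd₁
  -- Taking `t` to be `1/ N` treats `N` on either side of `N₂` at once; `K₁ ≈ K₂` turns maximality
  -- of `K₂` at `N₂` into the bound by `K₁`.
  , maximal N₁<N₂ cd₁ (λ L cdL → ≤-respʳ-≈ (sym K₁≈K₂) (max₂ L cdL)) (0≤1/ N)
  where
  open RealNumbers ℝ using (sym)
  open RealProperties ℝ
  open CurvatureDimension ℝ G
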